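{- For every $m\ge 1$, $\sup(\Lambda_{2m}^m)\ge \lceil (3m^2-2m+1)/2\rceil$; that is, every matrix in $\Lambda_{2m}^m$ has a critical set of size at least $\lceil (3m^2-2m+1)/2\rceil$.
   Context: $\Lambda_{n}^{x}$ is the set of $n\times n$ $(0,1)$-matrices with every row sum and every column sum equal to $x$. A matrix $M$ is identified with the set of triples $\{(i,j,M_{ij})\}$. A subset $D\subseteq M$ is a defining set for $M$ if $M$ is the unique element of $\Lambda_{2m}^m$ containing $D$; a critical set is a defining set none of whose proper subsets is a defining set; its size is its number of triples. For $M\in\Lambda_{2m}^m$, $\mathrm{lcs}(M)$ is the largest size of a critical set of $M$, and $\sup(\Lambda_{2m}^m)=\min\{\mathrm{lcs}(M): M\in\Lambda_{2m}^m\}$. -}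

module Defs where

open import Data.Nat using (ℕ; _+_)
open import Data.Bool using (Bool; true; false; if_then_else_)
open import Data.Fin using (Fin)
open import Data.List using (List; map; allFin)
open import Data.Nat.ListAction using (sum)
open import Data.Product using (Σ; ∃; _×_)
open import Relation.Binary.PropositionalEquality using (_≡_)
open import Relation.Nullary using (¬_)

Matrix : ℕ → Set
Matrix n = Fin n → Fin n → Bool

b2n : Bool → ℕ
b2n true  = 1
b2n false = 0

rowSum : ∀ {n} → Matrix n → Fin n → ℕ
rowSum {n} M i = sum (map (λ j → b2n (M i j)) (allFin n))

colSum : ∀ {n} → Matrix n → Fin n → ℕ
colSum {n} M j = sum (map (λ i → b2n (M i j)) (allFin n))

InΛ : (n x : ℕ) → Matrix n → Set
InΛ n x M = (∀ i → rowSum M i ≡ x) × (∀ j → colSum M j ≡ x)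

-- A subset D ⊆ M of the triples {(i,j,M_ij)} is determined by the set of
-- positions (i,j) it contains; we represent it by its characteristic function.
Positions : ℕ → Set
Positions n = Fin n → Fin n → Bool

size : ∀ {n} → Positions n → ℕ
size {n} S = sum (map (λ i → sum (map (λ j → b2n (S i j)) (allFin n))) (allFin n))

Contains : ∀ {n} → Matrix n → Matrix n → Positions n → Set
Contains M' M S = ∀ i j → S i j ≡ true → M' i j ≡ M i j

Defining : (m : ℕ) → Matrix (m + m) → Positions (m + m) → Set
Defining m M S = ∀ (M' : Matrix (m + m)) → InΛ (m + m) m M' → Contains M' M S →
                 ∀ i j → M' i j ≡ M i j

ProperSubset : ∀ {n} → Positions n → Positions n → Set
ProperSubset S' S = (∀ i j → S' i j ≡ true → S i j ≡ true) ×
                    (∃ λ i → ∃ λ j → (S i j ≡ true) × (S' i j ≡ false))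

Critical : (m : ℕ) → Matrix (m + m) → Positions (m + m) → Set
Critical m M S = Defining m M S × (∀ S' → ProperSubset S' S → ¬ Defining m M S')

{-# OPTIONS --safe #-}

-- Read M as an orientation of K(2m,2m): an entry 1 at (i , j) is the arc i → j, an
-- entry 0 the arc j → i.  Cells on which M may change form directed cycles, so the
-- complement of an acyclic set of arcs is a defining set, and a critical set inside
-- it must contain every cell that closes a cycle with that acyclic set.  Take an arc
-- r → c, with R₁ the other in-neighbours and R₂ the out-neighbours of c, C₁ the other
-- out-neighbours and C₂ the in-neighbours of r.  The arcs that go forward in the order
--   C₂ < r < C₁ < R₁ < c < R₂
-- close a 4-cycle with each 1 in R₂ × C and each 1 in R₁ × C₂; those that go forward in
--   R₁ < c < R₂ < C₂ < r < C₁
-- close a 4-cycle with each 0 in a column of C₁, each 0 in R₁ × C₂, and (r , c).  Since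
-- |R₁| = m - 1 and |C₂| = m, these two families together have
-- m² + m(m - 1) + m(m - 1) + 1 = 3m² - 2m + 1 cells, so one of them has at least half as many.
module Submission where

open import Defs
open import Data.Nat using (ℕ; _+_; _*_; _∸_; _≥_; ⌈_/2⌉)
open import Data.Product using (∃; _×_)

import Algebra.Properties.Semiring.Sum
open import Data.Bool using (Bool; T; true; false; not; _∧_; _∨_; _xor_; if_then_else_)
import Data.Bool.Properties as Bool
open import Data.Fin using (Fin; zero; suc; _≟_; combine; remQuot)
open import Data.Fin.Properties using (all?; any?; remQuot-combine)
open import Data.Fin.Subset using (Subset)
open import Data.Fin.Subset.Properties using (anySubset?)
open import Data.List using ([]; _∷_; map; allFin; tabulate; cartesianProduct)
open import Data.List.Membership.Propositional using (_∈_)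
open import Data.List.Membership.Propositional.Properties using (∈-allFin; ∈-cartesianProduct⁺)
open import Data.List.Properties using (map-tabulate)
open import Data.List.Relation.Unary.Any using (here; there)
open import Data.Nat using (zero; suc; _≤_; _<_; _<ᵇ_; z≤n; s≤s)
open import Data.Nat.ListAction using () renaming (sum to sumₗ)
import Data.Nat.Properties as ℕ
open import Data.Nat.Tactic.RingSolver using (solve-∀)
open import Data.Product using (Σ; _,_; proj₁; proj₂; uncurry)
open import Data.Sum using (_⊎_; inj₁; inj₂; [_,_]′)
open import Data.Unit using (tt)
import Data.Vec as Vec
open import Data.Vec.Properties using (lookup∘tabulate)
open import Function using (_∘_; _$_)
open import Relation.Binary.PropositionalEquality
open import Relation.Nullary using (¬_; Dec; yes; no; does; contradiction; _×-dec_; ¬?; _→-dec_)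
open import Relation.Nullary.Decidable using (dec-true; dec-false)

open Algebra.Properties.Semiring.Sum ℕ.+-*-semiring
  using (sum; sum-cong-≗; sum-replicate-zero; ∑-distrib-+; ∑-comm; *-distribˡ-sum; *-distribʳ-sum)

private
  variable
    n : ℕ
    f g : Fin n → ℕ

-- Finite sums and counts of Boolean functions.

sum-allFin : (f : Fin n → ℕ) → sumₗ (map f (allFin n)) ≡ sum f
sum-allFin f = trans (cong sumₗ (map-tabulate (λ i → i) f)) (sum-tabulate f)
  where
  sum-tabulate : ∀ {n} (f : Fin n → ℕ) → sumₗ (tabulate f) ≡ sum f
  sum-tabulate {zero}  f = refl
  sum-tabulate {suc n} f = cong (f zero +_) (sum-tabulate (f ∘ suc))

rowSum-sum : (M : Matrix n) (i : Fin n) → rowSum M i ≡ sum λ j → b2n (M i j)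
rowSum-sum M i = sum-allFin λ j → b2n (M i j)

colSum-sum : (M : Matrix n) (j : Fin n) → colSum M j ≡ sum λ i → b2n (M i j)
colSum-sum M j = sum-allFin λ i → b2n (M i j)

size-sum : (S : Positions n) → size S ≡ sum λ i → sum λ j → b2n (S i j)
size-sum S = trans (sum-allFin (rowSum S)) (sum-cong-≗ λ i → sum-allFin λ j → b2n (S i j))

sum-mono : (∀ i → f i ≤ g i) → sum f ≤ sum g
sum-mono {zero}  le = z≤n
sum-mono {suc n} le = ℕ.+-mono-≤ (le zero) (sum-mono (le ∘ suc))

sum-≤-≡ : (∀ i → f i ≤ g i) → sum f ≡ sum g → ∀ i → f i ≡ g i
sum-≤-≡ {suc n} {f} {g} le eq = λ where
    zero    → head-≡
    (suc i) → sum-≤-≡ (le ∘ suc) (ℕ.+-cancelˡ-≡ (f zero) _ _ (trans eq (cong (_+ sum (g ∘ suc)) (sym head-≡)))) i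
  where
  head-≡ : f zero ≡ g zero
  head-≡ = ℕ.≤-antisym (le zero) (ℕ.+-cancelʳ-≤ (sum (f ∘ suc)) _ _
    (subst (g zero + sum (f ∘ suc) ≤_) (sym eq) (ℕ.+-monoʳ-≤ (g zero) (sum-mono (le ∘ suc)))))

sum-replicate : ∀ n x → sum {n} (λ _ → x) ≡ n * x
sum-replicate zero    x = refl
sum-replicate (suc n) x = cong (x +_) (sum-replicate n x)

δ : Fin n → Fin n → ℕ
δ k i = b2n (does (i ≟ k))

sum-δ : (k : Fin n) → sum (δ k) ≡ 1
sum-δ {suc n} zero    = cong suc (sum-replicate-zero n)
sum-δ {suc n} (suc k) = sum-δ k

b2n-injective : ∀ x y → b2n x ≡ b2n y → x ≡ y
b2n-injective true  true  _ = refl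
b2n-injective false false _ = refl

b2n-mono : ∀ x y → (x ≡ true → y ≡ true) → b2n x ≤ b2n y
b2n-mono false _ _ = z≤n
b2n-mono true  y h rewrite h refl = s≤s z≤n

sum-b2n-⊆ : (f g : Fin n → Bool) → sum (b2n ∘ f) ≡ sum (b2n ∘ g) →
            (∀ i → f i ≡ true → g i ≡ true) → ∀ i → f i ≡ g i
sum-b2n-⊆ f g eq f⊆g i =
  b2n-injective (f i) (g i) (sum-≤-≡ (λ i → b2n-mono (f i) (g i) (f⊆g i)) eq i)

-- Without such an `l`, `g` would lie inside `f`, and equal counts would make them coincide, against
-- `k`. Applied to two rows or two columns, this supplies the missing corner of a 4-cycle.
equal-sum-exchange : (f g : Fin n → Bool) → sum (b2n ∘ f) ≡ sum (b2n ∘ g) →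
                     ∀ {k} → f k ≡ true → g k ≡ false → ∃ λ l → f l ≡ false × g l ≡ true
equal-sum-exchange f g eq {k} fk gk with any? (λ l → (f l Bool.≟ false) ×-dec (g l Bool.≟ true))
... | yes found = found
... | no none = contradiction (trans (sym gk) (trans (sum-b2n-⊆ g f (sym eq) g⊆f k) fk)) λ ()
  where
  g⊆f : ∀ i → g i ≡ true → f i ≡ true
  g⊆f i gi with f i in fi
  ... | true  = refl
  ... | false = contradiction (i , fi , gi) none

sum-not : (f : Fin n → Bool) → sum (b2n ∘ f) + sum (b2n ∘ not ∘ f) ≡ n
sum-not {n} f = begin
  sum (b2n ∘ f) + sum (b2n ∘ not ∘ f)      ≡⟨ ∑-distrib-+ (b2n ∘ f) (b2n ∘ not ∘ f) ⟨
  sum (λ i → b2n (f i) + b2n (not (f i)))  ≡⟨ sum-cong-≗ (λ i → b2n-not (f i)) ⟩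
  sum {n} (λ _ → 1)                        ≡⟨ sum-replicate n 1 ⟩
  n * 1                                    ≡⟨ ℕ.*-identityʳ n ⟩
  n                                        ∎
  where
  open ≡-Reasoning
  b2n-not : ∀ x → b2n x + b2n (not x) ≡ 1
  b2n-not true  = refl
  b2n-not false = refl

-- Sets of positions and removal of one cell.

_⊆_ : Positions n → Positions n → Set
S ⊆ T = ∀ i j → S i j ≡ true → T i j ≡ true

_∖_ : Positions n → Fin n × Fin n → Positions n
(S ∖ (a , b)) i j = S i j ∧ not (does ((i ≟ a) ×-dec (j ≟ b)))

∖-⊆ : (S : Positions n) (e : Fin n × Fin n) → (S ∖ e) ⊆ S
∖-⊆ S e i j = Bool.∧-conicalˡ (S i j) _

∖-self : (S : Positions n) (a b : Fin n) → (S ∖ (a , b)) a b ≡ false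
∖-self S a b = trans
  (cong (λ x → S a b ∧ not x) (dec-true ((a ≟ a) ×-dec (b ≟ b)) (refl , refl)))
  (Bool.∧-zeroʳ (S a b))

∖-mono : {S T : Positions n} (e : Fin n × Fin n) → S ⊆ T → (S ∖ e) ⊆ (T ∖ e)
∖-mono {S = S} e S⊆T i j h =
  cong₂ _∧_ (S⊆T i j (Bool.∧-conicalˡ (S i j) _ h)) (Bool.∧-conicalʳ (S i j) _ h)

⊆-∖ : {S T : Positions n} {a b : Fin n} → S ⊆ T → S a b ≡ false → S ⊆ (T ∖ (a , b))
⊆-∖ {S = S} {a = a} {b} S⊆T Sab i j h = cong₂ _∧_ (S⊆T i j h)
  (cong not (dec-false ((i ≟ a) ×-dec (j ≟ b)) λ { (refl , refl) → contradiction (trans (sym h) Sab) λ () }))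

size-mono : {S T : Positions n} → S ⊆ T → size S ≤ size T
size-mono {S = S} {T} S⊆T = subst₂ _≤_ (sym (size-sum S)) (sym (size-sum T))
  (sum-mono λ i → sum-mono λ j → b2n-mono (S i j) (T i j) (S⊆T i j))

-- Deciding the defining property and extracting a critical set.

InΛ-cong : ∀ {x} {M N : Matrix n} → (∀ i j → M i j ≡ N i j) → InΛ n x M → InΛ n x N
InΛ-cong {M = M} {N} M≗N (rows , cols) =
  (λ i → trans (trans (rowSum-sum N i) (trans (sum-cong-≗ λ j → cong b2n (sym (M≗N i j))) (sym (rowSum-sum M i)))) (rows i)) ,
  (λ j → trans (trans (colSum-sum N j) (trans (sum-cong-≗ λ i → cong b2n (sym (M≗N i j))) (sym (colSum-sum M j)))) (cols j))

_≗?_ : (M N : Matrix n) → Dec (∀ i j → M i j ≡ N i j)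
M ≗? N = all? λ i → all? λ j → M i j Bool.≟ N i j

-- Matrices as subsets of the cells, which `anySubset?` can search exhaustively. The round trip
-- returns a matrix only up to pointwise equality, hence the congruence lemmas.
decode : Subset (n * n) → Matrix n
decode v i j = Vec.lookup v (combine i j)

encode : Matrix n → Subset (n * n)
encode {n} M = Vec.tabulate (uncurry M ∘ remQuot n)

decode-encode : (M : Matrix n) → ∀ i j → decode (encode M) i j ≡ M i j
decode-encode {n} M i j =
  trans (lookup∘tabulate (uncurry M ∘ remQuot n) (combine i j)) (cong (uncurry M) (remQuot-combine i j))

module _ (m : ℕ) (M : Matrix (m + m)) where

  Counterexample : Positions (m + m) → Matrix (m + m) → Set
  Counterexample S N = InΛ (m + m) m N × Contains N M S × ¬ (∀ i j → N i j ≡ M i j)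

  counterexample? : ∀ S N → Dec (Counterexample S N)
  counterexample? S N =
    ((all? λ i → rowSum N i ℕ.≟ m) ×-dec (all? λ j → colSum N j ℕ.≟ m))
    ×-dec (all? λ i → all? λ j → (S i j Bool.≟ true) →-dec (N i j Bool.≟ M i j))
    ×-dec ¬? (N ≗? M)

  Counterexample-cong : ∀ {S N N'} → (∀ i j → N i j ≡ N' i j) → Counterexample S N → Counterexample S N'
  Counterexample-cong N≗N' (inΛ , contains , N≢M) =
    InΛ-cong N≗N' inΛ ,
    (λ i j s → trans (sym (N≗N' i j)) (contains i j s)) ,
    (λ N'≗M → N≢M λ i j → trans (N≗N' i j) (N'≗M i j))

  defining? : ∀ S → Dec (Defining m M S)
  defining? S with anySubset? (counterexample? S ∘ decode)
  ... | yes (v , inΛ , contains , N≢M) = no λ defining → N≢M (defining (decode v) inΛ contains)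
  ... | no none = yes λ N inΛ contains → case-≗ N inΛ contains (N ≗? M)
    where
    case-≗ : ∀ N → InΛ (m + m) m N → Contains N M S → Dec (∀ i j → N i j ≡ M i j) → ∀ i j → N i j ≡ M i j
    case-≗ N inΛ contains (yes N≗M) = N≗M
    case-≗ N inΛ contains (no N≢M) = contradiction
      (encode N , Counterexample-cong (λ i j → sym (decode-encode N i j)) (inΛ , contains , N≢M)) none

  Defining-mono : ∀ {S T} → S ⊆ T → Defining m M S → Defining m M T
  Defining-mono S⊆T defining N inΛ contains = defining N inΛ λ i j s → contains i j (S⊆T i j s)

  -- Greedy deletion with one test per cell. A cell found indispensable stays so after later
  -- deletions, since by `Defining-mono` a subset of a non-defining set is non-defining.
  prune : ∀ es S → Defining m M S → ∃ λ T → T ⊆ S × Defining m M T ×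
          (∀ a b → (a , b) ∈ es → T a b ≡ true → ¬ Defining m M (T ∖ (a , b)))
  prune [] S defining = S , (λ _ _ s → s) , defining , λ _ _ ()
  prune (e ∷ es) S defining with prune es S defining
  ... | T , T⊆S , T-defining , minimal with defining? (T ∖ e)
  ...   | yes T∖e-defining = T ∖ e , (λ i j t → T⊆S i j (∖-⊆ T e i j t)) , T∖e-defining , λ where
            a b (here refl)  t → contradiction (trans (sym t) (∖-self T a b)) λ ()
            a b (there ab∈es) t → minimal a b ab∈es (∖-⊆ T e a b t) ∘ Defining-mono (∖-mono (a , b) (∖-⊆ T e))
  ...   | no T∖e-not-defining = T , T⊆S , T-defining , λ where
            a b (here refl)  _ → T∖e-not-defining
            a b (there ab∈es) t → minimal a b ab∈es t

  -- Single-cell deletions suffice: a proper subset misses some cell, so it lies in the set with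
  -- just that cell removed.
  critical-subset : ∀ S → Defining m M S → ∃ λ T → T ⊆ S × Critical m M T
  critical-subset S defining
    with prune (cartesianProduct (allFin _) (allFin _)) S defining
  ... | T , T⊆S , T-defining , minimal = T , T⊆S , T-defining , λ where
    T' (T'⊆T , a , b , Tab , T'ab) → minimal a b (∈-cartesianProduct⁺ (∈-allFin a) (∈-allFin b)) Tab
      ∘ Defining-mono (⊆-∖ T'⊆T T'ab)

-- Acyclic orders and defining sets.

-- The cells whose arc goes from a lower to a higher rank, ρ ranking rows and σ columns.
forward : Matrix n → (ρ σ : Fin n → ℕ) → Positions n
forward M ρ σ i j = if M i j then ρ i <ᵇ σ j else σ j <ᵇ ρ i

-- Ties in rank count as backward, so forward arcs strictly increase the rank and are acyclic for
-- every `ρ` and `σ`.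
backward : Matrix n → (ρ σ : Fin n → ℕ) → Positions n
backward M ρ σ i j = not (forward M ρ σ i j)

<ᵇ-sound : ∀ {a b} → (a <ᵇ b) ≡ true → a < b
<ᵇ-sound {a} {b} h = ℕ.<ᵇ⇒< a b (subst T (sym h) tt)

-- Rather than extracting a directed cycle from the cells where `N` and `M` differ, the vertices are
-- settled in increasing rank; the prescribed row and column sums fix the balance at each.
backward-Defining : ∀ {m} {M : Matrix (m + m)} → InΛ (m + m) m M → ∀ ρ σ → Defining m M (backward M ρ σ)
backward-Defining {m} {M} (rows , cols) ρ σ N (N-rows , N-cols) contains i j = agrees (M i j) refl
  where
  -- Once all arcs with a tail of rank below k agree, a vertex of rank k has no
  -- lost in-arcs, so its balance forbids losing an out-arc.
  agree : ∀ k → (∀ i j → ρ i < k → M i j ≡ true → N i j ≡ true)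
              × (∀ i j → σ j < k → M i j ≡ false → N i j ≡ false)
  agree zero = (λ _ _ ()) , (λ _ _ ())
  agree (suc k) = row-agree , col-agree
    where
    open Σ (agree k) renaming (proj₁ to rows<k; proj₂ to cols<k)
    row-agree : ∀ i j → ρ i < suc k → M i j ≡ true → N i j ≡ true
    row-agree i j (s≤s ρi≤k) Mij = trans (sum-b2n-⊆ (N i) (M i) sums N⊆M j) Mij
      where
      sums : sum (b2n ∘ N i) ≡ sum (b2n ∘ M i)
      sums = trans (sym (rowSum-sum N i)) (trans (trans (N-rows i) (sym (rows i))) (rowSum-sum M i))
      -- The in-arcs of row `i` are its 0s. A forward one has a tail of rank below `k` and is
      -- settled by induction; a backward one is prescribed by `contains`.
      N⊆M : ∀ j → N i j ≡ true → M i j ≡ true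
      N⊆M j Nij with M i j in Mij | σ j <ᵇ ρ i in fwd | contains i j
      ... | true  | _     | _  = refl
      ... | false | true  | _  = trans (sym (cols<k i j (ℕ.<-≤-trans (<ᵇ-sound fwd) ρi≤k) Mij)) Nij
      ... | false | false | eq = trans (sym (eq refl)) Nij
    col-agree : ∀ i j → σ j < suc k → M i j ≡ false → N i j ≡ false
    col-agree i j (s≤s σj≤k) Mij = trans (sym (sum-b2n-⊆ (λ i → M i j) (λ i → N i j) sums M⊆N i)) Mij
      where
      sums : sum (λ i → b2n (M i j)) ≡ sum (λ i → b2n (N i j))
      sums = trans (sym (colSum-sum M j)) (trans (trans (cols j) (sym (N-cols j))) (colSum-sum N j))
      M⊆N : ∀ i → M i j ≡ true → N i j ≡ true
      M⊆N i Mij with M i j in Mij′ | ρ i <ᵇ σ j in fwd | contains i j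
      ... | true  | true  | _  = rows<k i j (ℕ.<-≤-trans (<ᵇ-sound fwd) σj≤k) Mij′
      ... | true  | false | eq = eq refl
      ... | false | _     | _  = contradiction Mij λ ()
  agrees : ∀ x → M i j ≡ x → N i j ≡ x
  agrees true  = proj₁ (agree (suc (ρ i))) i j ℕ.≤-refl
  agrees false = proj₂ (agree (suc (σ j))) i j ℕ.≤-refl

-- Reversing a directed 4-cycle.

pair : Fin n → Fin n → Fin n → Bool
pair k l i = does (i ≟ k) ∨ does (i ≟ l)

sum-xor-pair : (f : Fin n → Bool) {k l : Fin n} → f l ≡ not (f k) →
               sum (λ i → b2n (f i xor pair k l i)) ≡ sum (b2n ∘ f)
sum-xor-pair {n} f {k} {l} fl = by-value (f k) refl
  where
  toggle : ∀ {k l} → f k ≡ true → f l ≡ false → sum (λ i → b2n (f i xor pair k l i)) ≡ sum (b2n ∘ f)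
  -- The flip loses `k` and gains `l`; adding `δ k` to one side and `δ l` to the other avoids
  -- subtraction.
  toggle {k} {l} fk fl = ℕ.+-cancelʳ-≡ 1 _ _ $ begin
      sum (λ i → b2n (f i xor pair k l i)) + 1          ≡⟨ cong (sum (λ i → b2n (f i xor pair k l i)) +_) (sum-δ k) ⟨
      sum (λ i → b2n (f i xor pair k l i)) + sum (δ k)  ≡⟨ ∑-distrib-+ (λ i → b2n (f i xor pair k l i)) (δ k) ⟨
      sum (λ i → b2n (f i xor pair k l i) + δ k i)      ≡⟨ sum-cong-≗ pointwise ⟩
      sum (λ i → b2n (f i) + δ l i)                     ≡⟨ ∑-distrib-+ (b2n ∘ f) (δ l) ⟩
      sum (b2n ∘ f) + sum (δ l)                         ≡⟨ cong (sum (b2n ∘ f) +_) (sum-δ l) ⟩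
      sum (b2n ∘ f) + 1                                 ∎
    where
    open ≡-Reasoning
    pointwise : ∀ i → b2n (f i xor pair k l i) + δ k i ≡ b2n (f i) + δ l i
    pointwise i with i ≟ k | i ≟ l
    ... | yes refl | yes refl = contradiction (trans (sym fk) fl) λ ()
    ... | yes refl | no _     rewrite fk = refl
    ... | no _     | yes refl rewrite fl = refl
    ... | no _     | no _     = cong (λ x → b2n x + 0) (Bool.xor-identityʳ (f i))
  by-value : ∀ x → f k ≡ x → sum (λ i → b2n (f i xor pair k l i)) ≡ sum (b2n ∘ f)
  by-value true  fk = toggle fk (trans fl (cong not fk))
  by-value false fk = trans
    (sum-cong-≗ λ i → cong (λ x → b2n (f i xor x)) (Bool.∨-comm (does (i ≟ k)) (does (i ≟ l))))
    (toggle (trans fl (cong not fk)) fk)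

-- A directed 4-cycle through the cell (i , j) with its three other arcs in `A`. Stating the values
-- relative to `M i j` covers both directions of the arc.
record Switch (M : Matrix n) (A : Positions n) (i j : Fin n) : Set where
  constructor switch
  field
    {i′ j′} : Fin n
    Mi′j    : M i′ j ≡ not (M i j)
    Mij′    : M i j′ ≡ not (M i j)
    Mi′j′   : M i′ j′ ≡ M i j
    Ai′j    : A i′ j ≡ true
    Aij′    : A i j′ ≡ true
    Ai′j′   : A i′ j′ ≡ true

switch-valued : ∀ {M : Matrix n} {A i j i′ j′ x} → M i j ≡ x → M i′ j ≡ not x → M i j′ ≡ not x → M i′ j′ ≡ x →
                A i′ j ≡ true → A i j′ ≡ true → A i′ j′ ≡ true → Switch M A i j
switch-valued refl = switch

-- Reversing the 4-cycle preserves all row and column sums and changes only (i , j) and cells of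
-- `A`, all of them outside `S`.
Switch⇒¬Defining : ∀ {m} {M : Matrix (m + m)} → InΛ (m + m) m M → {A S : Positions (m + m)} {i j : Fin (m + m)} →
                   (∀ a b → S a b ≡ true → A a b ≡ false) → S i j ≡ false → Switch M A i j → ¬ Defining m M S
Switch⇒¬Defining {m} {M} (rows , cols) {A} {S} {i} {j} disjoint Sij
  (switch {i′} {j′} Mi′j Mij′ Mi′j′ Ai′j Aij′ Ai′j′) defining =
  Bool.not-¬ refl (trans (sym (defining N (N-rows , N-cols) contains i j))
    (trans (cong (M i j xor_) corner) (Bool.xor-comm (M i j) true)))
  where
  N : Matrix (m + m)
  N a b = M a b xor (pair i i′ a ∧ pair j j′ b)
  corner : pair i i′ i ∧ pair j j′ j ≡ true
  corner rewrite dec-true (i ≟ i) refl | dec-true (j ≟ j) refl = refl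
  -- Serves rows and columns alike: `x` tells whether the line meets the 2 × 2 block, in which case
  -- its two corner values are opposite.
  line : (f : Fin (m + m) → Bool) (k l : Fin (m + m)) → ∀ x → (x ≡ true → f l ≡ not (f k)) →
         sum (λ b → b2n (f b xor (x ∧ pair k l b))) ≡ sum (b2n ∘ f)
  line f k l true  fl = sum-xor-pair f (fl refl)
  line f k l false _  = sum-cong-≗ λ b → cong b2n (Bool.xor-identityʳ (f b))
  row-alternates : ∀ a → pair i i′ a ≡ true → M a j′ ≡ not (M a j)
  row-alternates a h with a ≟ i | a ≟ i′
  ... | yes refl | _        = Mij′
  ... | no _     | yes refl = trans Mi′j′ (trans (sym (Bool.not-involutive (M i j))) (cong not (sym Mi′j)))
  ... | no _     | no _     = contradiction h λ ()
  col-alternates : ∀ b → pair j j′ b ≡ true → M i′ b ≡ not (M i b)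
  col-alternates b h with b ≟ j | b ≟ j′
  ... | yes refl | _        = Mi′j
  ... | no _     | yes refl = trans Mi′j′ (trans (sym (Bool.not-involutive (M i j))) (cong not (sym Mij′)))
  ... | no _     | no _     = contradiction h λ ()
  N-rows : ∀ a → rowSum N a ≡ m
  N-rows a = trans (rowSum-sum N a) (trans (line (M a) j j′ (pair i i′ a) (row-alternates a))
    (trans (sym (rowSum-sum M a)) (rows a)))
  N-cols : ∀ b → colSum N b ≡ m
  N-cols b = trans (colSum-sum N b) (trans
    (sum-cong-≗ λ a → cong (λ x → b2n (M a b xor x)) (Bool.∧-comm (pair i i′ a) (pair j j′ b)))
    (trans (line (λ a → M a b) i i′ (pair j j′ b) (col-alternates b))
    (trans (sym (colSum-sum M b)) (cols b))))
  contains : Contains N M S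
  contains a b Sab with a ≟ i | a ≟ i′ | b ≟ j | b ≟ j′
  ... | no _     | no _     | _        | _        = Bool.xor-identityʳ (M a b)
  ... | yes _    | _        | no _     | no _     = Bool.xor-identityʳ (M a b)
  ... | no _     | yes _    | no _     | no _     = Bool.xor-identityʳ (M a b)
  ... | yes refl | _        | yes refl | _        = contradiction (trans (sym Sab) Sij) λ ()
  ... | yes refl | _        | no _     | yes refl = contradiction (trans (sym Aij′) (disjoint _ _ Sab)) λ ()
  ... | no _     | yes refl | yes refl | _        = contradiction (trans (sym Ai′j) (disjoint _ _ Sab)) λ ()
  ... | no _     | yes refl | no _     | yes refl = contradiction (trans (sym Ai′j′) (disjoint _ _ Sab)) λ ()

-- A critical set chosen among the backward cells must contain each cell of `D`: otherwise the
-- 4-cycle of that cell would avoid the set entirely.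
critical-⊇-switchable : ∀ {m} {M : Matrix (m + m)} → InΛ (m + m) m M → ∀ ρ σ {D : Positions (m + m)} →
  (∀ i j → D i j ≡ true → Switch M (forward M ρ σ) i j) → ∃ λ S → Critical m M S × size D ≤ size S
critical-⊇-switchable {m} {M} inΛ ρ σ {D} switchable
  with critical-subset m M (backward M ρ σ) (backward-Defining {m} inΛ ρ σ)
... | S , S⊆backward , critical = S , critical , size-mono D⊆S
  where
  disjoint : ∀ a b → S a b ≡ true → forward M ρ σ a b ≡ false
  disjoint a b Sab = Bool.not-injective (S⊆backward a b Sab)
  D⊆S : D ⊆ S
  D⊆S i j Dij with S i j in Sij
  ... | true  = refl
  ... | false = contradiction (proj₁ critical) (Switch⇒¬Defining {m} inΛ disjoint Sij (switchable i j Dij))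

-- Ranks constant on blocks of rows or columns.

level : Fin n → (Fin n → Bool) → (a b d : ℕ) → Fin n → ℕ
level k f a b d i = if does (i ≟ k) then a else if f i then b else d

module _ (k : Fin n) (f : Fin n → Bool) {a b d : ℕ} where

  level-self : level k f a b d k ≡ a
  level-self rewrite dec-true (k ≟ k) refl = refl

  level-true : ∀ {i} → i ≢ k → f i ≡ true → level k f a b d i ≡ b
  level-true {i} i≢k fi rewrite dec-false (i ≟ k) i≢k | fi = refl

  level-false : f k ≡ true → ∀ {i} → f i ≡ false → level k f a b d i ≡ d
  level-false fk {i} fi rewrite dec-false (i ≟ k) (λ { refl → contradiction (trans (sym fk) fi) λ () }) | fi = refl

module Arcs (M : Matrix n) (ρ σ : Fin n → ℕ) where

  -- The ranks enter through equations, so that for numerals `a` and `b` the comparison is proved by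
  -- `refl`.
  forward-1 : ∀ {i j a b} → M i j ≡ true → ρ i ≡ a → σ j ≡ b → (a <ᵇ b) ≡ true → forward M ρ σ i j ≡ true
  forward-1 Mij refl refl a<b rewrite Mij = a<b

  forward-0 : ∀ {i j a b} → M i j ≡ false → ρ i ≡ a → σ j ≡ b → (b <ᵇ a) ≡ true → forward M ρ σ i j ≡ true
  forward-0 Mij refl refl b<a rewrite Mij = b<a

-- Double sums of products.

sum₂ : (Fin n → Fin n → ℕ) → ℕ
sum₂ f = sum λ i → sum (f i)

sum₂-+ : (f g : Fin n → Fin n → ℕ) → sum₂ (λ i j → f i j + g i j) ≡ sum₂ f + sum₂ g
sum₂-+ f g = trans (sum-cong-≗ λ i → ∑-distrib-+ (f i) (g i)) (∑-distrib-+ (sum ∘ f) (sum ∘ g))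

sum₂-*-rows : (f : Fin n → ℕ) (g : Fin n → Fin n → ℕ) {x : ℕ} → (∀ i → sum (g i) ≡ x) →
              sum₂ (λ i j → f i * g i j) ≡ sum f * x
sum₂-*-rows f g {x} eq = trans
  (sum-cong-≗ λ i → trans (sym (*-distribˡ-sum (f i) (g i))) (cong (f i *_) (eq i)))
  (sym (*-distribʳ-sum x f))

sum₂-*-cols : (f : Fin n → ℕ) (g : Fin n → Fin n → ℕ) {x : ℕ} → (∀ j → sum (λ i → g i j) ≡ x) →
              sum₂ (λ i j → f j * g i j) ≡ sum f * x
sum₂-*-cols f g eq = trans (∑-comm λ i j → f j * g i j) (sum₂-*-rows f (λ j i → g i j) eq)

-- The two families of switchable cells and their total size.

module _ {m : ℕ} {M : Matrix (m + m)} (inΛ : InΛ (m + m) m M) where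

  private
    row : ∀ i → sum (λ j → b2n (M i j)) ≡ m
    row i = trans (sym (rowSum-sum M i)) (proj₁ inΛ i)

    col : ∀ j → sum (λ i → b2n (M i j)) ≡ m
    col j = trans (sym (colSum-sum M j)) (proj₂ inΛ j)

    half-not : (f : Fin (m + m) → Bool) → sum (b2n ∘ f) ≡ m → sum (b2n ∘ not ∘ f) ≡ m
    half-not f eq = ℕ.+-cancelˡ-≡ m _ _ (trans (cong (_+ sum (b2n ∘ not ∘ f)) (sym eq)) (sum-not f))

  row-exchange : ∀ i i′ {j} → M i j ≡ true → M i′ j ≡ false → ∃ λ l → M i l ≡ false × M i′ l ≡ true
  row-exchange i i′ = equal-sum-exchange (M i) (M i′) (trans (row i) (sym (row i′)))

  col-exchange : ∀ j j′ {i} → M i j ≡ true → M i j′ ≡ false → ∃ λ l → M l j ≡ false × M l j′ ≡ true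
  col-exchange j j′ = equal-sum-exchange (λ i → M i j) (λ i → M i j′) (trans (col j) (sym (col j′)))

  private
    m≢0 : Fin (m + m) → m ≢ 0
    m≢0 () refl

  row-one : ∀ i → ∃ λ j → M i j ≡ true
  row-one i with any? (λ j → M i j Bool.≟ true)
  ... | yes found = found
  ... | no none = contradiction (trans (sym (row i)) (trans (sum-cong-≗ λ j → cong b2n (Bool.¬-not λ Mij → none (j , Mij)))
    (sum-replicate-zero (m + m)))) (m≢0 i)

  col-zero : ∀ j → ∃ λ i → M i j ≡ false
  col-zero j with any? (λ i → M i j Bool.≟ false)
  ... | yes found = found
  ... | no none = contradiction (trans (sym (half-not (λ i → M i j) (col j)))
    (trans (sum-cong-≗ λ i → cong (b2n ∘ not) (Bool.¬-not λ Mij → none (i , Mij))) (sum-replicate-zero (m + m)))) (m≢0 j)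

  module _ {r c : Fin (m + m)} (Mrc : M r c ≡ true) where

    -- `D₁` vanishes on row `r` and column `c`. `D₂` has to exclude that row and column explicitly,
    -- apart from (r , c): their 0s, in r × C₂ and R₂ × c, are forward arcs in the second order.
    D₁ D₂ : Positions (m + m)
    D₁ i j = M i j ∧ (not (M i c) ∨ not (M r j))
    D₂ i j = (not (does (i ≟ r)) ∧ not (does (j ≟ c)) ∧ not (M i j) ∧ (M i c ∨ M r j))
           ∨ (does (i ≟ r) ∧ does (j ≟ c))

    private
      separated : ∀ {A : Set} {x : A} {f : A → Bool} {y : A} → f x ≡ true → f y ≡ false → x ≢ y
      separated fx fy refl = contradiction (trans (sym fx) fy) λ ()

    module _ {a b d : ℕ} where

      rank-r : level r (λ i → M i c) a b d r ≡ a
      rank-r = level-self r (λ i → M i c)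

      rank-R₁ : ∀ {i} → i ≢ r → M i c ≡ true → level r (λ i → M i c) a b d i ≡ b
      rank-R₁ = level-true r (λ i → M i c)

      rank-R₂ : ∀ {i} → M i c ≡ false → level r (λ i → M i c) a b d i ≡ d
      rank-R₂ = level-false r (λ i → M i c) Mrc

      rank-c : level c (M r) a b d c ≡ a
      rank-c = level-self c (M r)

      rank-C₁ : ∀ {j} → j ≢ c → M r j ≡ true → level c (M r) a b d j ≡ b
      rank-C₁ = level-true c (M r)

      rank-C₂ : ∀ {j} → M r j ≡ false → level c (M r) a b d j ≡ d
      rank-C₂ = level-false c (M r) Mrc

    -- Places in the two orders, counted from 0. The numerals are the ranks of r, R₁, R₂ for rows
    -- and of c, C₁, C₂ for columns.
    ρ₁ σ₁ ρ₂ σ₂ : Fin (m + m) → ℕ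
    ρ₁ = level r (λ i → M i c) 1 3 5
    σ₁ = level c (M r) 4 2 0
    ρ₂ = level r (λ i → M i c) 4 0 2
    σ₂ = level c (M r) 1 5 3

    private
      module Arcs₁ = Arcs M ρ₁ σ₁
      module Arcs₂ = Arcs M ρ₂ σ₂

    D₁-switchable : ∀ i j → D₁ i j ≡ true → Switch M (forward M ρ₁ σ₁) i j
    D₁-switchable i j h with M i j in Mij | M i c in Mic | M r j in Mrj
    -- The cycle i → j → r → c → i.
    ... | true | false | false = switch-valued Mij Mrj Mic Mrc
      (Arcs₁.forward-0 Mrj rank-r (rank-C₂ Mrj) refl)
      (Arcs₁.forward-0 Mic (rank-R₂ Mic) rank-c refl)
      (Arcs₁.forward-1 Mrc rank-r rank-c refl)
    -- Here r → j, so another row `u` of R₁ takes the place of `r`: i → j → u → c → i.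
    ... | true | false | true = via (col-exchange j c Mij Mic)
      where
      j≢c : j ≢ c
      j≢c = separated Mij Mic
      via : (∃ λ u → M u j ≡ false × M u c ≡ true) → Switch M (forward M ρ₁ σ₁) i j
      via (u , Muj , Muc) = switch-valued Mij Muj Mic Muc
        (Arcs₁.forward-0 Muj (rank-R₁ u≢r Muc) (rank-C₁ j≢c Mrj) refl)
        (Arcs₁.forward-0 Mic (rank-R₂ Mic) rank-c refl)
        (Arcs₁.forward-1 Muc (rank-R₁ u≢r Muc) rank-c refl)
        where
        u≢r : u ≢ r
        u≢r = ≢-sym (separated {f = λ i → M i j} Mrj Muj)
    -- Here i → c, so a column `l` of C₁ takes the place of `c`: i → j → r → l → i.
    ... | true | true | false = via (row-exchange i r Mij Mrj)
      where
      i≢r : i ≢ r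
      i≢r = separated {f = λ i → M i j} Mij Mrj
      via : (∃ λ l → M i l ≡ false × M r l ≡ true) → Switch M (forward M ρ₁ σ₁) i j
      via (l , Mil , Mrl) = switch-valued Mij Mrj Mil Mrl
        (Arcs₁.forward-0 Mrj rank-r (rank-C₂ Mrj) refl)
        (Arcs₁.forward-0 Mil (rank-R₁ i≢r Mic) (rank-C₁ l≢c Mrl) refl)
        (Arcs₁.forward-1 Mrl rank-r (rank-C₁ l≢c Mrl) refl)
        where
        l≢c : l ≢ c
        l≢c = ≢-sym (separated Mic Mil)

    D₂-switchable : ∀ i j → D₂ i j ≡ true → Switch M (forward M ρ₂ σ₂) i j
    D₂-switchable i j h with i ≟ r | j ≟ c
    -- The cycle r → c → u → l → r, with `u` in R₂ and `l` in C₂.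
    ... | yes refl | yes refl = via-row (col-zero c)
      where
      via-col : ∀ {u} → M u c ≡ false → (∃ λ l → M r l ≡ false × M u l ≡ true) → Switch M (forward M ρ₂ σ₂) r c
      via-col Muc (l , Mrl , Mul) = switch-valued Mrc Muc Mrl Mul
        (Arcs₂.forward-0 Muc (rank-R₂ Muc) rank-c refl)
        (Arcs₂.forward-0 Mrl rank-r (rank-C₂ Mrl) refl)
        (Arcs₂.forward-1 Mul (rank-R₂ Muc) (rank-C₂ Mrl) refl)
      via-row : (∃ λ u → M u c ≡ false) → Switch M (forward M ρ₂ σ₂) r c
      via-row (u , Muc) = via-col Muc (row-exchange r u Mrc Muc)
    ... | no i≢r | no j≢c with M i j in Mij | M r j in Mrj | M i c in Mic
    -- The cycle j → i → l → r → j with `l` in C₂. Both R₁ and R₂ rank below C₂, so i → l is forward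
    -- whichever block holds `i`.
    ...   | false | true | x = via (row-exchange r i Mrj Mij)
      where
      via : (∃ λ l → M r l ≡ false × M i l ≡ true) → Switch M (forward M ρ₂ σ₂) i j
      via (l , Mrl , Mil) = switch-valued Mij Mrj Mil Mrl
        (Arcs₂.forward-1 Mrj rank-r (rank-C₁ j≢c Mrj) refl)
        (i→l x Mic)
        (Arcs₂.forward-0 Mrl rank-r (rank-C₂ Mrl) refl)
        where
        i→l : ∀ x → M i c ≡ x → forward M ρ₂ σ₂ i l ≡ true
        i→l true  Mic = Arcs₂.forward-1 Mil (rank-R₁ i≢r Mic) (rank-C₂ Mrl) refl
        i→l false Mic = Arcs₂.forward-1 Mil (rank-R₂ Mic) (rank-C₂ Mrl) refl
    -- The cycle j → i → c → u → j with `u` in R₂.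
    ...   | false | false | true = via (col-exchange c j Mic Mij)
      where
      via : (∃ λ u → M u c ≡ false × M u j ≡ true) → Switch M (forward M ρ₂ σ₂) i j
      via (u , Muc , Muj) = switch-valued Mij Muj Mic Muc
        (Arcs₂.forward-1 Muj (rank-R₂ Muc) (rank-C₂ Mrj) refl)
        (Arcs₂.forward-1 Mic (rank-R₁ i≢r Mic) rank-c refl)
        (Arcs₂.forward-0 Muc (rank-R₂ Muc) rank-c refl)

    -- The m + m on the left pays for the row r in R₁ × C₂ and the column c in R₂ × C₁,
    -- which the sums on the right include, keeping all terms of the count nonnegative.
    size-D₁+size-D₂ : (size D₁ + size D₂) + (m + m) ≡ (m * m + m * m) + (m * m + 1)
    size-D₁+size-D₂ = begin
      (size D₁ + size D₂) + (m + m)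
        ≡⟨ cong₂ _+_ (cong₂ _+_ (size-sum D₁) (size-sum D₂)) (sym (cong₂ _+_ (δ-row zeros-r) (δ-col zeros-c))) ⟩
      (sum₂ d₁ + sum₂ d₂) + (sum₂ (λ i j → δ r i * b2n (not (M r j))) + sum₂ (λ i j → δ c j * b2n (not (M i c))))
        ≡⟨ cong₂ _+_ (sum₂-+ d₁ d₂) (sum₂-+ (λ i j → δ r i * b2n (not (M r j))) (λ i j → δ c j * b2n (not (M i c)))) ⟨
      sum₂ (λ i j → d₁ i j + d₂ i j) + sum₂ (λ i j → δ r i * b2n (not (M r j)) + δ c j * b2n (not (M i c)))
        ≡⟨ sum₂-+ (λ i j → d₁ i j + d₂ i j) (λ i j → δ r i * b2n (not (M r j)) + δ c j * b2n (not (M i c))) ⟨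
      sum₂ (λ i j → (d₁ i j + d₂ i j) + (δ r i * b2n (not (M r j)) + δ c j * b2n (not (M i c))))
        ≡⟨ sum-cong-≗ (λ i → sum-cong-≗ λ j → pointwise i j) ⟩
      sum₂ (λ i j → (t₁ i j + t₂ i j) + (t₃ i j + δ r i * δ c j))
        ≡⟨ sum₂-+ (λ i j → t₁ i j + t₂ i j) (λ i j → t₃ i j + δ r i * δ c j) ⟩
      sum₂ (λ i j → t₁ i j + t₂ i j) + sum₂ (λ i j → t₃ i j + δ r i * δ c j)
        ≡⟨ cong₂ _+_ (sum₂-+ t₁ t₂) (sum₂-+ t₃ λ i j → δ r i * δ c j) ⟩
      (sum₂ t₁ + sum₂ t₂) + (sum₂ t₃ + sum₂ (λ i j → δ r i * δ c j))
        ≡⟨ cong₂ _+_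
             (cong₂ _+_ (trans (sum₂-*-rows (λ i → b2n (not (M i c))) (λ i j → b2n (M i j)) row) (cong (_* m) zeros-c))
                        (trans (sum₂-*-rows (λ i → b2n (M i c)) (λ i j → b2n (not (M r j))) λ _ → zeros-r) (cong (_* m) (col c))))
             (cong₂ _+_ (trans (sum₂-*-cols (λ j → b2n (M r j)) (λ i j → b2n (not (M i j))) λ j → half-not (λ i → M i j) (col j)) (cong (_* m) (row r)))
                        (trans (sum₂-*-rows (δ r) (λ i → δ c) λ _ → sum-δ c) (cong (_* 1) (sum-δ r)))) ⟩
      (m * m + m * m) + (m * m + 1) ∎
      where
      open ≡-Reasoning
      d₁ d₂ t₁ t₂ t₃ : Fin (m + m) → Fin (m + m) → ℕ
      d₁ i j = b2n (D₁ i j)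
      d₂ i j = b2n (D₂ i j)
      -- `t₁` counts the 1s in the rows of R₂ and `t₃` the 0s in the columns of C₁ and c. On R₁ × C₂
      -- the family `D₁` takes the 1s and `D₂` the 0s, so together they fill the block; `t₂` counts
      -- all its cells, and those of r × C₂.
      t₁ i j = b2n (not (M i c)) * b2n (M i j)
      t₂ i j = b2n (M i c) * b2n (not (M r j))
      t₃ i j = b2n (M r j) * b2n (not (M i j))
      zeros-r : sum (λ j → b2n (not (M r j))) ≡ m
      zeros-r = half-not (M r) (row r)
      zeros-c : sum (λ i → b2n (not (M i c))) ≡ m
      zeros-c = half-not (λ i → M i c) (col c)
      δ-row : sum (λ j → b2n (not (M r j))) ≡ m → sum₂ (λ i j → δ r i * b2n (not (M r j))) ≡ m
      δ-row eq = trans (sum₂-*-rows (δ r) (λ i j → b2n (not (M r j))) λ _ → eq)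
        (trans (cong (_* m) (sum-δ r)) (ℕ.*-identityˡ m))
      δ-col : sum (λ i → b2n (not (M i c))) ≡ m → sum₂ (λ i j → δ c j * b2n (not (M i c))) ≡ m
      δ-col eq = trans (sum₂-*-cols (δ c) (λ i j → b2n (not (M i c))) λ _ → eq)
        (trans (cong (_* m) (sum-δ c)) (ℕ.*-identityˡ m))
      pointwise : ∀ i j → (d₁ i j + d₂ i j) + (δ r i * b2n (not (M r j)) + δ c j * b2n (not (M i c)))
                        ≡ (t₁ i j + t₂ i j) + (t₃ i j + δ r i * δ c j)
      pointwise i j with i ≟ r | j ≟ c
      pointwise i j | yes refl | yes refl rewrite Mrc = refl
      pointwise i j | yes refl | no _     rewrite Mrc with M r j
      ... | true  = refl
      ... | false = refl
      pointwise i j | no _     | yes refl rewrite Mrc with M i c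
      ... | true  = refl
      ... | false = refl
      pointwise i j | no _     | no _     with M i j | M i c | M r j
      ... | true  | true  | true  = refl
      ... | true  | true  | false = refl
      ... | true  | false | true  = refl
      ... | true  | false | false = refl
      ... | false | true  | true  = refl
      ... | false | true  | false = refl
      ... | false | false | true  = refl
      ... | false | false | false = refl

-- Choosing the larger family.

⌈/2⌉-split : ∀ {a b k} → a + b ≡ k → ⌈ k /2⌉ ≤ a ⊎ ⌈ k /2⌉ ≤ b
⌈/2⌉-split {a} {b} refl with ℕ.≤-total a b
... | inj₁ a≤b = inj₂ (ℕ.≤-trans (ℕ.⌈n/2⌉-mono (ℕ.+-monoˡ-≤ b a≤b)) (ℕ.≤-reflexive (sym (ℕ.n≡⌈n+n/2⌉ b))))
... | inj₂ b≤a = inj₁ (ℕ.≤-trans (ℕ.⌈n/2⌉-mono (ℕ.+-monoʳ-≤ a b≤a)) (ℕ.≤-reflexive (sym (ℕ.n≡⌈n+n/2⌉ a))))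

theorem18 : ∀ (m : ℕ) → m ≥ 1 → ∀ (M : Matrix (m + m)) → InΛ (m + m) m M →
    ∃ λ (S : Positions (m + m)) → Critical m M S × (size S ≥ ⌈ (3 * m * m + 1) ∸ (2 * m) /2⌉)
-- Any 1 of the matrix can serve as the arc r → c; one is taken from the first row, which exists
-- because `m` is a successor.
theorem18 m@(suc _) _ M inΛ = from-one (row-one inΛ zero)
  where
  from-one : (∃ λ c → M zero c ≡ true) →
             ∃ λ S → Critical m M S × (size S ≥ ⌈ (3 * m * m + 1) ∸ (2 * m) /2⌉)
  from-one (c , Mrc) = [ conclude (critical-⊇-switchable {m} inΛ (ρ₁ inΛ Mrc) (σ₁ inΛ Mrc) (D₁-switchable inΛ Mrc))
                       , conclude (critical-⊇-switchable {m} inΛ (ρ₂ inΛ Mrc) (σ₂ inΛ Mrc) (D₂-switchable inΛ Mrc)) ]′ (⌈/2⌉-split total)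
    where
    total : size (D₁ inΛ Mrc) + size (D₂ inΛ Mrc) ≡ (3 * m * m + 1) ∸ (2 * m)
    total = begin
      -- Adding and cancelling `m + m` brings the subtraction-free count to the truncated form of
      -- the bound.
      size (D₁ inΛ Mrc) + size (D₂ inΛ Mrc)                        ≡⟨ ℕ.m+n∸n≡m _ (m + m) ⟨
      (size (D₁ inΛ Mrc) + size (D₂ inΛ Mrc)) + (m + m) ∸ (m + m)  ≡⟨ cong (_∸ (m + m)) (size-D₁+size-D₂ inΛ Mrc) ⟩
      (m * m + m * m) + (m * m + 1) ∸ (m + m)                      ≡⟨ cong₂ _∸_ (three m) (two m) ⟩
      (3 * m * m + 1) ∸ (2 * m)                                    ∎
      where
      open ≡-Reasoning
      three : ∀ m → (m * m + m * m) + (m * m + 1) ≡ 3 * m * m + 1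
      three = solve-∀
      two : ∀ m → m + m ≡ 2 * m
      two = solve-∀
    conclude : ∀ {D : Positions (m + m)} {k} → (∃ λ S → Critical m M S × size D ≤ size S) → k ≤ size D →
               ∃ λ S → Critical m M S × size S ≥ k
    conclude (S , critical , D≤S) k≤D = S , critical , ℕ.≤-trans k≤D D≤S
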